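{- Let $k\ge 2$ be a constant. Every deterministic $\mathsf{Online}$-$\mathsf{LOCAL}$ algorithm that properly colors every $n$-node $k$-partite graph using at most $2k-2$ colors has locality $\Omega(n)$.
   Context: A graph is $k$-partite if it admits a proper coloring with $k$ colors. For a graph $G=(V,E)$, $U\subseteq V$ and an integer $T\ge 0$, $\mathcal{B}(U,T)$ denotes the set of nodes at distance at most $T$ from some node of $U$, and $G[U]$ denotes the induced subgraph. The $\mathsf{Online}$-$\mathsf{LOCAL}$ model: an algorithm with locality $T=T(n)$ is deterministic and knows $n$. The adversary chooses an $n$-node input graph $G=(V,E)$ from the input family, assigns distinct identifiers from $\{1,\dots,\mathrm{poly}(n)\}$ to its nodes, and chooses an ordering $\sigma=(v_1,\dots,v_n)$ of $V$. For $i=1,\dots,n$, when $v_i$ is presented, the algorithm must irrevocably assign an output (here a color) to $v_i$ as a function of the sequence $(v_1,\dots,v_i)$ and the induced subgraph $G_i=G\big[\bigcup_{j\le i}\mathcal{B}(v_j,T)\big]$ (with identifiers); thus the algorithm has global memory of everything seen so far. The algorithm solves a coloring problem on an input family if for every choice of the adversary the final coloring is proper and uses only the allowed colors. The locality of a problem is the minimum locality of an algorithm solving it. -}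

module Defs where

open import Data.Fin.Base as Fin using (Fin; toℕ)
open import Data.Fin.Permutation using (Permutation′; _⟨$⟩ʳ_; _⟨$⟩ˡ_)
open import Data.Fin.Properties as Fin using (any?)
open import Data.Fin.Subset using (Subset)
open import Data.List.Base using (List; take)
import Data.List.Base as List
open import Data.Nat.Base using (ℕ; zero; suc; _+_; _*_; _^_; _≤_)
open import Data.Product.Base using (∃-syntax; _×_; _,_)
open import Data.Vec.Base using (Vec)
import Data.Vec.Base as Vec
open import Function.Bundles using (_↣_; module Injection)
open import Level using (0ℓ)
open import Relation.Binary.Core using (Rel)
open import Relation.Binary.Definitions
  using (Decidable; Symmetric; Irreflexive)
open import Relation.Binary.PropositionalEquality.Core
  using (_≡_; _≢_; refl)
open import Relation.Nullary.Decidable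
  using (Dec; does; map′; _×-dec_)

record Graph (n : ℕ) : Set₁ where
  field
    Adj        : Rel (Fin n) 0ℓ
    adj?       : Decidable Adj
    adj-sym    : Symmetric Adj
    adj-irrefl : Irreflexive _≡_ Adj

module _ {n : ℕ} (G : Graph n) where
  open Graph G

  Proper : {C : Set} → (Fin n → C) → Set
  Proper f = ∀ {u v} → Adj u v → f u ≢ f v

  Partite : ℕ → Set
  Partite k = ∃[ f ] Proper {Fin k} f

  data Walk : ℕ → Fin n → Fin n → Set where
    []  : ∀ {u} → Walk zero u u
    _∷_ : ∀ {ℓ u v w} → Adj u v → Walk ℓ v w → Walk (suc ℓ) u w

  walk? : ∀ ℓ → Decidable (Walk ℓ)
  walk? zero u v = map′ (λ { refl → [] }) (λ { [] → refl }) (u Fin.≟ v)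
  walk? (suc ℓ) u w =
    map′ (λ { (_ , a , p) → a ∷ p }) (λ { (a ∷ p) → _ , a , p })
      (any? λ v → adj? u v ×-dec walk? ℓ v w)

  -- v ∈ 𝓑(u , T): some walk from u to v has length at most T.
  Ball : Fin n → ℕ → Fin n → Set
  Ball u T v = ∃[ ℓ ] Walk (toℕ {suc T} ℓ) u v

  ball? : ∀ u T v → Dec (Ball u T v)
  ball? u T v = any? λ ℓ → walk? (toℕ ℓ) u v

-- The adversary's choices.  The element a of Fin N stands for the
-- identifier 1 + toℕ a ∈ {1, …, N}.
record Input (n N : ℕ) : Set₁ where
  field
    graph : Graph n
    ident : Fin n ↣ Fin N
    order : Permutation′ n

  open Graph graph public
  open Injection ident public using () renaming (to to idOf)

  node : Fin n → Fin n
  node i = order ⟨$⟩ʳ i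

  position : Fin n → Fin n
  position v = order ⟨$⟩ˡ v

-- What an algorithm is shown, expressed through identifiers only: the
-- sequence of nodes presented so far, and the vertex set and adjacency
-- matrix of the revealed induced subgraph.  This is first-order data, so
-- indistinguishable situations give propositionally equal views.
record View (N : ℕ) : Set where
  constructor view
  field
    presented : List (Fin N)
    vertices  : Subset N
    edges     : Vec (Subset N) N

module _ {n N : ℕ} (I : Input n N) (T : ℕ) (i : Fin n) where
  open Input I

  -- The vertex set of G_i.
  Revealed : Fin n → Set
  Revealed u = ∃[ j ] (j Fin.≤ i × Ball graph (node j) T u)

  revealed? : ∀ u → Dec (Revealed u)
  revealed? u = any? λ j → (j Fin.≤? i) ×-dec ball? graph (node j) T u

  VertexId : Fin N → Set
  VertexId a = ∃[ u ] (idOf u ≡ a × Revealed u)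

  vertexId? : ∀ a → Dec (VertexId a)
  vertexId? a = any? λ u → (idOf u Fin.≟ a) ×-dec revealed? u

  EdgeId : Fin N → Fin N → Set
  EdgeId a b = ∃[ u ] ∃[ v ]
    ((idOf u ≡ a × Revealed u) × (idOf v ≡ b × Revealed v) × Adj u v)

  edgeId? : ∀ a b → Dec (EdgeId a b)
  edgeId? a b = any? λ u → any? λ v →
    ((idOf u Fin.≟ a) ×-dec revealed? u) ×-dec
    (((idOf v Fin.≟ b) ×-dec revealed? v) ×-dec adj? u v)

  viewAt : View N
  viewAt = view
    (take (suc (toℕ i)) (List.tabulate λ j → idOf (node j)))
    (Vec.tabulate λ a → does (vertexId? a))
    (Vec.tabulate λ a → Vec.tabulate λ b → does (edgeId? a b))

-- A deterministic Online-LOCAL algorithm with outputs in O; on n-node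
-- graphs the identifiers come from {1, …, N n}.
record OnlineLocal (N : ℕ → ℕ) (O : Set) : Set where
  field
    locality : ℕ → ℕ
    output   : (n : ℕ) → View (N n) → O

  run : ∀ {n} → Input n (N n) → Fin n → O
  run {n} I v = output n (viewAt I (locality n) (Input.position I v))

ProperlyColors : ∀ {N O} → OnlineLocal N O →
                 (∀ {n} → Graph n → Set) → Set₁
ProperlyColors {N} A Family =
  ∀ {n} (I : Input n (N n)) → Family (Input.graph I) →
  Proper (Input.graph I) (OnlineLocal.run A I)

-- The bound N n = poly(n).  The lower bound on N is there because
-- n distinct identifiers must exist.
record PolynomialIdSpace (N : ℕ → ℕ) : Set where
  field
    enough     : ∀ n → n ≤ N n
    polynomial : ∃[ d ] ∀ n → N n ≤ n ^ d + d

-- f ∈ Ω(g), the implied positive constant being written as 1 / c.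
_∈Ω_ : (ℕ → ℕ) → (ℕ → ℕ) → Set
f ∈Ω g = ∃[ c ] ∃[ n₀ ] ∀ n → n₀ ≤ n → g n ≤ c * f n

{-# OPTIONS --safe #-}
-- A gadget is the tensor product K_k × K_k: cells (i , j) and (i′ , j′) are
-- adjacent iff i ≢ i′ and j ≢ j′, so each colour seen twice is confined to one
-- row or one column.  If some row and some column are both rainbow, they show
-- 2k − 1 colours; if every row and every column has a repetition, there are 2k
-- colours.  With 2k − 2 colours, a gadget thus has exactly one of two
-- orientations.  Joining consecutive gadgets of a chain by the same adjacency
-- rule forces a constant orientation along the chain.  Transposing everything
-- beyond a cut in the middle gives an isomorphic, hence still k-partite, chain.
-- If the two end gadgets are presented first and lie further than T from the
-- cut, the algorithm cannot tell the two chains apart and colours the ends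
-- equally in both, yet the orientations must agree in one chain and be opposite
-- in the other.  This needs only k² (2T + 3) nodes.
module Submission where

open import Defs
open import Data.Bool.Base using (Bool; true; false)
open import Data.Fin.Base
  using (Fin; zero; suc; toℕ; fromℕ; inject₁; inject≤; splitAt; join; punchIn;
         combine; remQuot; _↑ˡ_)
open import Data.Fin.Induction using (<-weakInduction)
open import Data.Fin.Permutation as Perm using (Permutation′; _⟨$⟩ʳ_; _⟨$⟩ˡ_)
open import Data.Fin.Properties
  using (_≟_; any?; all?; ¬∀⟶∃¬; injective⇒≤; join-splitAt; punchIn-injective;
         punchInᵢ≢i; toℕ-inject₁; toℕ-fromℕ; toℕ≤pred[n]; toℕ-↑ˡ;
         splitAt-↑ˡ; splitAt⁻¹-↑ˡ; remQuot-combine; combine-remQuot;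
         combine-monoˡ-<; inject≤-injective)
import Data.Nat.Base as ℕ
open import Data.Nat.Base using (ℕ; zero; suc; _+_; _*_; _∸_; _≤_; _<_; z≤n; s≤s)
open import Data.Nat.Properties hiding (_≟_)
open import Data.Nat.Solver using (module +-*-Solver)
open import Data.Product.Base as Product
  using (∃-syntax; _×_; _,_; proj₁; proj₂; swap; uncurry)
open import Data.Sum.Base using (_⊎_; inj₁; inj₂; [_,_]′)
import Data.Vec.Properties as Vec
open import Function.Base using (_∘_; flip; const; id)
open import Function.Bundles using (mk⇔; mk↣)
open import Function.Definitions using (Injective)
open import Relation.Binary.PropositionalEquality
open import Relation.Nullary.Decidable
  using (Dec; yes; no; does; does-⇔; dec-true; _×-dec_; ¬?; decidable-stable)
open import Relation.Nullary.Negation using (¬_; contradiction)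

-- Counting colours in gadgets.

disjoint-injections⇒+≤ : ∀ {m n p} {a : Fin m → Fin p} {b : Fin n → Fin p} →
  Injective _≡_ _≡_ a → Injective _≡_ _≡_ b → (∀ i j → a i ≢ b j) →
  m + n ≤ p
disjoint-injections⇒+≤ {m} {n} {p} {a} {b} a-inj b-inj a≢b =
  injective⇒≤ λ {i} {j} eq →
    trans (sym (join-splitAt m n i))
      (trans (cong (join m n) (sum-inj (splitAt m i) (splitAt m j) eq))
        (join-splitAt m n j))
  where
  sum-inj : ∀ x y → [ a , b ]′ x ≡ [ a , b ]′ y → x ≡ y
  sum-inj (inj₁ i) (inj₁ j) eq = cong inj₁ (a-inj eq)
  sum-inj (inj₁ i) (inj₂ j) eq = contradiction eq (a≢b i j)
  sum-inj (inj₂ i) (inj₁ j) eq = contradiction (sym eq) (a≢b j i)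
  sum-inj (inj₂ i) (inj₂ j) eq = cong inj₂ (b-inj eq)

module _ {k : ℕ} {C : Set} where

  Compatible : (f g : Fin k → Fin k → C) → Set
  Compatible f g = ∀ {i i′ j j′} → i ≢ i′ → j ≢ j′ → f i j ≢ g i′ j′

  RowRepeat : (Fin k → Fin k → C) → Fin k → Set
  RowRepeat f i = ∃[ j ] ∃[ j′ ] (j ≢ j′ × f i j ≡ f i j′)

  RowsRepeat : (Fin k → Fin k → C) → Set
  RowsRepeat f = ∀ i → RowRepeat f i

  compatible-flip : ∀ {f g} → Compatible f g → Compatible (flip f) (flip g)
  compatible-flip f∼g i≢i′ j≢j′ = f∼g j≢j′ i≢i′

  rowsRepeat-cong : ∀ {f g} → (∀ i j → f i j ≡ g i j) →
                    RowsRepeat f → RowsRepeat g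
  rowsRepeat-cong f≗g rows i with rows i
  ... | j , j′ , j≢j′ , eq =
    j , j′ , j≢j′ , trans (sym (f≗g i j)) (trans eq (f≗g i j′))

  module Shade {f : Fin k → Fin k → C} (rows : RowsRepeat f) where

    shade : Fin k → C
    shade i = f i (proj₁ (rows i))

    avoid : ∀ i c → ∃[ j ] (j ≢ c × f i j ≡ shade i)
    avoid i c with rows i
    ... | j , j′ , j≢j′ , eq with j ≟ c
    ...   | no j≢c   = j , j≢c , refl
    ...   | yes refl = j′ , j≢j′ ∘ sym , sym eq

    -- Taking the shade of row `i` outside the column chosen for row `i′` yields two cells in
    -- different rows and columns, where compatibility forbids equal colours.
    shade-injective : Compatible f f → Injective _≡_ _≡_ shade
    shade-injective f∼f {i} {i′} eq = decidable-stable (i ≟ i′) λ i≢i′ →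
      let j , j≢ , eq′ = avoid i (proj₁ (rows i′)) in
      f∼f i≢i′ j≢ (trans eq′ eq)

-- One colour per row and one per column: 2 k colours, pairwise distinct
-- because the choice in a repetition can dodge any given row or column.
rows-columns-clash : ∀ {k c} {f g : Fin k → Fin k → Fin c} →
  Compatible f f → Compatible g g → Compatible f g →
  RowsRepeat f → RowsRepeat (flip g) → k + k ≤ c
rows-columns-clash {f = f} {g} f∼f g∼g f∼g rows cols =
  disjoint-injections⇒+≤ (R.shade-injective f∼f)
    (K.shade-injective (compatible-flip {f = g} {g} g∼g)) λ r c eq →
      let j , j≢c , eqʳ = R.avoid r c
          i , i≢r , eqᶜ = K.avoid c r
      in f∼g (i≢r ∘ sym) j≢c (trans eqʳ (trans eq (sym eqᶜ)))
  where
  module R = Shade {f = f} rows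
  module K = Shade {f = flip g} cols

rowRepeat? : ∀ {k c} (f : Fin k → Fin k → Fin c) i → Dec (RowRepeat f i)
rowRepeat? f i = any? λ j → any? λ j′ → ¬? (j ≟ j′) ×-dec (f i j ≟ f i j′)

no-repeat⇒injective : ∀ {k c} {f : Fin k → Fin k → Fin c} {i} →
  ¬ RowRepeat f i → Injective _≡_ _≡_ (f i)
no-repeat⇒injective ¬rep {j} {j′} eq =
  decidable-stable (j ≟ j′) λ j≢j′ → ¬rep (j , j′ , j≢j′ , eq)

rows-or-columns : ∀ {k c} {f : Fin k → Fin k → Fin c} → c < k + ℕ.pred k →
  Compatible f f → RowsRepeat f ⊎ RowsRepeat (flip f)
rows-or-columns {suc k} {c} {f} few f∼f
  with all? (rowRepeat? f) | all? (rowRepeat? (flip f))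
... | yes rows | _        = inj₁ rows
... | _        | yes cols = inj₂ cols
... | no ¬rows | no ¬cols
  with r , ¬row ← ¬∀⟶∃¬ _ _ (rowRepeat? f) ¬rows
     | s , ¬col ← ¬∀⟶∃¬ _ _ (rowRepeat? (flip f)) ¬cols
  -- Row `r` and column `s` are rainbow and share one cell; `punchIn r` drops it from the column,
  -- leaving `suc k + k` distinct colours.
  = contradiction few (≤⇒≯ (disjoint-injections⇒+≤
      {a = f r} {b = λ i → f (punchIn r i) s}
      (no-repeat⇒injective {f = f} ¬row)
      (λ {i} {j} eq → punchIn-injective r i j (no-repeat⇒injective {f = flip f} ¬col eq))
      cross))
  where
  cross : ∀ j i → f r j ≢ f (punchIn r i) s
  cross j i eq with j ≟ s
  ... | yes refl = punchInᵢ≢i r i (sym (no-repeat⇒injective {f = flip f} ¬col eq))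
  ... | no j≢s   = f∼f (punchInᵢ≢i r i ∘ sym) j≢s eq

-- Orientation along a chain.

Close : ∀ {m} → Fin m → Fin m → Set
Close p q = toℕ p ≤ suc (toℕ q) × toℕ q ≤ suc (toℕ p)

-- `Close` is reflexive, so this includes that each gadget by itself is properly coloured.
Chain : ∀ {m k} {C : Set} → (Fin m → Fin k → Fin k → C) → Set
Chain F = ∀ {p q} → Close p q → Compatible (F p) (F q)

close-refl : ∀ {m} {p : Fin m} → Close p p
close-refl = n≤1+n _ , n≤1+n _

module _ {m k c : ℕ} (few : c < k + ℕ.pred k) where

  c<k+k : c < k + k
  c<k+k = <-≤-trans few (+-monoʳ-≤ k (pred[n]≤n {k}))

  rowsRepeat-propagates : {F : Fin (suc m) → Fin k → Fin k → Fin c} →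
    Chain F → RowsRepeat (F zero) → ∀ p → RowsRepeat (F p)
  rowsRepeat-propagates {F} chain rows₀ =
    <-weakInduction (RowsRepeat ∘ F) rows₀ step
    where
    step : ∀ p → RowsRepeat (F (inject₁ p)) → RowsRepeat (F (suc p))
    step p rows with rows-or-columns few (chain (close-refl {p = suc p}))
    ... | inj₁ rows′ = rows′
    ... | inj₂ cols′ = contradiction c<k+k (≤⇒≯ (rows-columns-clash
      {f = F (inject₁ p)} {F (suc p)}
      (chain (close-refl {p = inject₁ p})) (chain (close-refl {p = suc p}))
      (chain (subst (_≤ suc (suc (toℕ p))) (sym (toℕ-inject₁ p)) (m≤n⇒m≤1+n (n≤1+n _))
             , s≤s (≤-reflexive (sym (toℕ-inject₁ p)))))
      rows cols′))

  -- Row repetitions propagate to `F p` along `F` and to `G p` along `G`. As `G p` is the transpose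
  -- of `F p`, the latter has repetitions in all rows and all columns.
  twisted-ends-clash-rows : {F G : Fin (suc m) → Fin k → Fin k → Fin c} →
    Chain F → Chain G → (∀ i j → F zero i j ≡ G zero i j) →
    ∀ p → (∀ i j → F p i j ≡ G p j i) → ¬ RowsRepeat (F zero)
  twisted-ends-clash-rows {F} {G} F-chain G-chain F≗G p F≗Gᵀ rows =
    contradiction c<k+k (≤⇒≯ (rows-columns-clash {f = F p} {F p} Fp Fp Fp
      (rowsRepeat-propagates {F} F-chain rows p)
      (rowsRepeat-cong (λ i j → sym (F≗Gᵀ j i))
        (rowsRepeat-propagates {G} G-chain (rowsRepeat-cong F≗G rows) p))))
    where
    Fp : Compatible (F p) (F p)
    Fp = F-chain (close-refl {p = p})

  twisted-ends-clash : {F G : Fin (suc m) → Fin k → Fin k → Fin c} →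
    Chain F → Chain G → (∀ i j → F zero i j ≡ G zero i j) →
    ∀ p → ¬ (∀ i j → F p i j ≡ G p j i)
  twisted-ends-clash {F} {G} F-chain G-chain F≗G p F≗Gᵀ
    with rows-or-columns {f = F zero} few (F-chain (close-refl {suc m} {zero}))
  ... | inj₁ rows = twisted-ends-clash-rows {F} {G} F-chain G-chain F≗G p F≗Gᵀ rows
  -- Transposing every gadget of both chains turns this into the case of rows.
  ... | inj₂ cols = twisted-ends-clash-rows {flip ∘ F} {flip ∘ G}
    (λ cl i≢ j≢ → F-chain cl j≢ i≢) (λ cl i≢ j≢ → G-chain cl j≢ i≢)
    (λ i j → F≗G j i) p (λ i j → F≗Gᵀ j i) cols

-- Chains of gadgets as graphs.

module _ {n m k : ℕ} (layer : Fin n → Fin m) (cell : Fin n → Fin k × Fin k) where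

  -- Several nodes may share a layer and a cell. They are then nonadjacent twins, which makes room
  -- for surplus nodes.
  gadgetChain : Graph n
  gadgetChain = record
    { Adj = λ u v → Close (layer u) (layer v) ×
        (proj₁ (cell u) ≢ proj₁ (cell v) × proj₂ (cell u) ≢ proj₂ (cell v))
    ; adj? = λ u v →
        ((toℕ (layer u) ≤? suc (toℕ (layer v))) ×-dec
         (toℕ (layer v) ≤? suc (toℕ (layer u)))) ×-dec
        (¬? (proj₁ (cell u) ≟ proj₁ (cell v)) ×-dec
         ¬? (proj₂ (cell u) ≟ proj₂ (cell v)))
    ; adj-sym = λ (cl , i≢ , j≢) → swap cl , i≢ ∘ sym , j≢ ∘ sym
    ; adj-irrefl = λ { refl (_ , i≢ , _) → i≢ refl }
    }

  gadgetChain-partite : Partite gadgetChain k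
  gadgetChain-partite = proj₁ ∘ cell , λ (_ , i≢ , _) → i≢

  proper⇒chain : {C : Set} {f : Fin n → C} → Proper gadgetChain f →
    (at : Fin m → Fin k × Fin k → Fin n) →
    (∀ p x → layer (at p x) ≡ p) → (∀ p x → cell (at p x) ≡ x) →
    Chain (λ p i j → f (at p (i , j)))
  proper⇒chain proper at layer-at cell-at {p} {q} cl {i} {i′} {j} {j′} i≢ j≢ =
    proper ( subst₂ Close (sym (layer-at p (i , j))) (sym (layer-at q (i′ , j′))) cl
           , subst₂ (λ x y → proj₁ x ≢ proj₁ y × proj₂ x ≢ proj₂ y)
               (sym (cell-at p (i , j))) (sym (cell-at q (i′ , j′))) (i≢ , j≢))

-- Indistinguishable inputs.

inOrder : ∀ {n N} → n ≤ N → Graph n → Input n N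
inOrder n≤N G = record
  { graph = G
  ; ident = mk↣ (λ {u} {v} → inject≤-injective n≤N n≤N u v)
  ; order = Perm.id
  }

module _ {n N : ℕ} (n≤N : n ≤ N) (T : ℕ) (i : Fin n) where

  Shown : Graph n → Fin n → Set
  Shown G = Revealed (inOrder n≤N G) T i

  Includes : Graph n → Graph n → Set
  Includes G H = (∀ {u} → Shown G u → Shown H u) ×
          (∀ {u v} → Shown G u → Shown G v → Graph.Adj G u v → Graph.Adj H u v)

  includes-antisym : ∀ {G H} → Includes G H → Includes H G →
    viewAt (inOrder n≤N G) T i ≡ viewAt (inOrder n≤N H) T i
  -- The presented identifiers do not depend on the graph, so only vertices and edges need
  -- comparing.
  includes-antisym {G} {H} G⊑H H⊑G = cong₂ (view _)
    (Vec.tabulate-cong λ a → does-⇔ (mk⇔ (vertex G⊑H) (vertex H⊑G))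
      (vertexId? I T i a) (vertexId? I′ T i a))
    (Vec.tabulate-cong λ a → Vec.tabulate-cong λ b →
      does-⇔ (mk⇔ (edge G⊑H) (edge H⊑G)) (edgeId? I T i a b) (edgeId? I′ T i a b))
    where
    I = inOrder n≤N G
    I′ = inOrder n≤N H
    vertex : ∀ {G H a} → Includes G H →
      VertexId (inOrder n≤N G) T i a → VertexId (inOrder n≤N H) T i a
    vertex (shown , _) (u , eq , s) = u , eq , shown s
    edge : ∀ {G H a b} → Includes G H →
      EdgeId (inOrder n≤N G) T i a b → EdgeId (inOrder n≤N H) T i a b
    edge (shown , adj) (u , v , (eq , s) , (eq′ , s′) , uv) =
      u , v , (eq , shown s) , (eq′ , shown s′) , adj s s′ uv

-- Balls that avoid the cut.

module _ {n m : ℕ} (layer : Fin n → Fin m) (T : ℕ) where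

  level : Fin n → ℕ
  level = toℕ ∘ layer

  Mirrored : ∀ {k} (cell cell′ : Fin n → Fin k × Fin k) → Set
  Mirrored cell cell′ = ∀ u → (level u ≤ T × cell u ≡ cell′ u) ⊎
                              (T < level u × cell u ≡ swap (cell′ u))

  -- Walks of length ℓ from u stay on u's side of the cut between layers T and
  -- T + 1.  On the far side they must also avoid layer T + 1 itself, so that no
  -- edge across the cut is ever visible.
  Clear : ℕ → Fin n → Set
  Clear ℓ u = ℓ + level u ≤ T ⊎ ℓ + (2 + T) ≤ level u

  ClearBefore : Fin n → Set
  ClearBefore v = ∀ u → toℕ u ≤ toℕ v → ∀ ℓ → ℓ ≤ T → Clear ℓ u

  clear-pred : ∀ {ℓ u} → Clear (suc ℓ) u → Clear ℓ u
  clear-pred (inj₁ low)  = inj₁ (<⇒≤ low)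
  clear-pred (inj₂ high) = inj₂ (<⇒≤ high)

  clear-zero : ∀ ℓ {u} → Clear ℓ u → Clear 0 u
  clear-zero zero    = id
  clear-zero (suc ℓ) = clear-zero ℓ ∘ clear-pred

  clear-step : ∀ {ℓ u v} → Close (layer u) (layer v) → Clear (suc ℓ) u → Clear ℓ v
  clear-step {ℓ} {u} (_ , v≤1+u) (inj₁ low) = inj₁ (begin
    ℓ + _             ≤⟨ +-monoʳ-≤ ℓ v≤1+u ⟩
    ℓ + suc (level u) ≡⟨ +-suc ℓ _ ⟩
    suc ℓ + level u   ≤⟨ low ⟩
    T                 ∎)
    where open ≤-Reasoning
  clear-step (u≤1+v , _) (inj₂ high) = inj₂ (ℕ.s≤s⁻¹ (≤-trans high u≤1+v))

  -- The hypotheses put `v` in layer `T + 1`, the only layer where `Clear 0` fails.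
  not-across : ∀ {u v} → level v ≤ suc (level u) → level u ≤ T → T < level v →
               ¬ Clear 0 v
  not-across v≤1+u u≤T T<v (inj₁ v≤T)   = <⇒≱ T<v v≤T
  not-across v≤1+u u≤T T<v (inj₂ 2+T≤v) =
    <⇒≱ 2+T≤v (≤-trans v≤1+u (s≤s u≤T))

  module _ {k : ℕ} {cell cell′ : Fin n → Fin k × Fin k} (mirrored : Mirrored cell cell′) where

    G G′ : Graph n
    G  = gadgetChain layer cell
    G′ = gadgetChain layer cell′

    mirrored-adj : ∀ {u v} → Clear 0 u → Clear 0 v → Graph.Adj G u v → Graph.Adj G′ u v
    mirrored-adj {u} {v} cu cv ((u≤ , v≤) , i≢ , j≢) with mirrored u | mirrored v
    ... | inj₁ (_ , eq)   | inj₁ (_ , eq′) rewrite eq | eq′ = (u≤ , v≤) , i≢ , j≢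
    ... | inj₂ (_ , eq)   | inj₂ (_ , eq′) rewrite eq | eq′ = (u≤ , v≤) , j≢ , i≢
    ... | inj₁ (u≤T , _)  | inj₂ (T<v , _) = contradiction cv (not-across {u} {v} v≤ u≤T T<v)
    ... | inj₂ (T<u , _)  | inj₁ (v≤T , _) = contradiction cu (not-across {v} {u} u≤ v≤T T<u)

    -- Each step spends one unit of clearance, so no edge of the walk crosses the cut. That the
    -- endpoint is clear serves to compare edges between revealed nodes.
    mirrored-walk : ∀ {ℓ u v} → Clear ℓ u → Walk G ℓ u v → Walk G′ ℓ u v × Clear 0 v
    mirrored-walk c [] = [] , c
    mirrored-walk {suc ℓ} {u} c (_∷_ {v = w} a p) =
      Product.map₁ (mirrored-adj (clear-zero (suc ℓ) {u} c) (clear-zero ℓ {w} c′) a ∷_)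
        (mirrored-walk c′ p)
      where
      c′ : Clear ℓ w
      c′ = clear-step {u = u} {w} (proj₁ a) c

    mirrored-includes : ∀ {N} (n≤N : n ≤ N) (i : Fin n) →
      ClearBefore i → Includes n≤N T i G G′
    mirrored-includes n≤N i clear = proj₁ ∘ shown , λ s s′ →
      mirrored-adj (proj₂ (shown s)) (proj₂ (shown s′))
      where
      shown : ∀ {u} → Shown n≤N T i G u → Shown n≤N T i G′ u × Clear 0 u
      shown (j , j≤i , ℓ , w) =
        let w′ , c = mirrored-walk (clear j j≤i (toℕ ℓ) (toℕ≤pred[n] ℓ)) w
        in (j , j≤i , ℓ , w′) , c

-- Transposing the far side of the cut.

swapIf : ∀ {A : Set} → Bool → A × A → A × A
swapIf true  = swap
swapIf false = id

swapIf-involutive : ∀ {A : Set} b (x : A × A) → swapIf b (swapIf b x) ≡ x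
swapIf-involutive true  _ = refl
swapIf-involutive false _ = refl

swapIf-beyond : ∀ {A : Set} {t l} (t<l? : Dec (t < l)) (x : A × A) →
  (l ≤ t × x ≡ swapIf (does t<l?) x) ⊎ (t < l × x ≡ swap (swapIf (does t<l?) x))
swapIf-beyond (yes t<l) _ = inj₂ (t<l , refl)
swapIf-beyond (no t≮l)  _ = inj₁ (≮⇒≥ t≮l , refl)

ColoursPartite : ∀ {N c} (n k T : ℕ) → (View N → Fin c) → Set₁
ColoursPartite {N} n k T out = ∀ (I : Input n N) → Partite (Input.graph I) k →
  Proper (Input.graph I) (λ v → out (viewAt I T (Input.position I v)))

module Twist {n m k T : ℕ} (layer : Fin n → Fin (suc m)) (cell : Fin n → Fin k × Fin k)
  (at : Fin (suc m) → Fin k × Fin k → Fin n)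
  (layer-at : ∀ p x → layer (at p x) ≡ p) (cell-at : ∀ p x → cell (at p x) ≡ x) where

  beyond : Fin (suc m) → Bool
  beyond p = does (suc T ≤? toℕ p)

  twistedCell : Fin n → Fin k × Fin k
  twistedCell v = swapIf (beyond (layer v)) (cell v)

  -- Twisting keeps nodes and layers and only relabels cells beyond the cut, so looking up a cell
  -- there has to swap first.
  twistedAt : Fin (suc m) → Fin k × Fin k → Fin n
  twistedAt p x = at p (swapIf (beyond p) x)

  twistedCell-twistedAt : ∀ p x → twistedCell (twistedAt p x) ≡ x
  twistedCell-twistedAt p x = trans
    (cong₂ (λ q y → swapIf (beyond q) y) (layer-at p _) (cell-at p _))
    (swapIf-involutive (beyond p) x)

  twistedAt-beyond : ∀ {p} → T < toℕ p → ∀ i j → twistedAt p (i , j) ≡ at p (j , i)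
  twistedAt-beyond {p} T<p i j =
    cong (λ b → at p (swapIf b (i , j))) (dec-true (suc T ≤? toℕ p) T<p)

  cell-mirrored : Mirrored layer T cell twistedCell
  cell-mirrored u = swapIf-beyond (suc T ≤? toℕ (layer u)) (cell u)

  mirrored-sym : Mirrored layer T twistedCell cell
  mirrored-sym u with cell-mirrored u
  ... | inj₁ (u≤T , eq) = inj₁ (u≤T , sym eq)
  ... | inj₂ (T<u , eq) = inj₂ (T<u , cong swap (sym eq))

  straight twisted : Graph n
  straight = gadgetChain layer cell
  twisted  = gadgetChain layer twistedCell

  module _ {N : ℕ} (n≤N : n ≤ N) where

    same-view : ∀ {v} → ClearBefore layer T v →
      viewAt (inOrder n≤N straight) T v ≡ viewAt (inOrder n≤N twisted) T v
    same-view {v} clear = includes-antisym n≤N T v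
      (mirrored-includes layer T cell-mirrored n≤N v clear)
      (mirrored-includes layer T mirrored-sym n≤N v clear)

    no-algorithm : ∀ {c last} → c < k + ℕ.pred k → T < toℕ last →
      (∀ x → ClearBefore layer T (at zero x)) → (∀ x → ClearBefore layer T (at last x)) →
      (out : View N → Fin c) →
      ¬ ColoursPartite n k T out
    no-algorithm {last = last} few T<last clear₀ clearₗ out proper =
      twisted-ends-clash few
        (proper⇒chain layer cell
          (proper (inOrder n≤N straight) (gadgetChain-partite layer cell)) at layer-at cell-at)
        (proper⇒chain layer twistedCell
          (proper (inOrder n≤N twisted) (gadgetChain-partite layer twistedCell)) twistedAt
          (λ p x → layer-at p _) twistedCell-twistedAt)
        -- At layer zero `beyond` computes to `false`, so both chains read the same node.
        (λ i j → cong out (same-view (clear₀ (i , j))))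
        last
        (λ i j → trans (cong out (same-view (clearₗ (i , j))))
          (cong (λ v → out (viewAt (inOrder n≤N twisted) T v))
            (sym (twistedAt-beyond T<last j i))))

-- Numbering the nodes in order of presentation.

-- The r surplus nodes are twins of the node at address d.
module Packing (m k r : ℕ) (d : Fin m × (Fin k × Fin k)) where

  pack : Fin m → Fin k × Fin k → Fin (m * (k * k) + r)
  pack b x = combine b (uncurry combine x) ↑ˡ r

  unpack : Fin (m * (k * k) + r) → Fin m × (Fin k × Fin k)
  unpack v = [ Product.map₂ (remQuot k) ∘ remQuot (k * k) , const d ]′
               (splitAt (m * (k * k)) v)

  unpack-pack : ∀ b x → unpack (pack b x) ≡ (b , x)
  unpack-pack b (i , j) = trans
    (cong [ Product.map₂ (remQuot k) ∘ remQuot (k * k) , const d ]′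
      (splitAt-↑ˡ (m * (k * k)) (combine b (combine i j)) r))
    (trans (cong (Product.map₂ (remQuot k)) (remQuot-combine b (combine i j)))
      (cong (b ,_) (remQuot-combine i j)))

  block : Fin (m * (k * k) + r) → Fin m
  block = proj₁ ∘ unpack

  -- Indices run through the chain block by block. Surplus nodes count towards the block of `d`,
  -- which is bounded by assumption.
  block-mono : ∀ {u} b x → toℕ (proj₁ d) ≤ toℕ b → toℕ u ≤ toℕ (pack b x) →
               toℕ (block u) ≤ toℕ b
  block-mono {u} b x d≤b u≤ with splitAt (m * (k * k)) u in eq
  ... | inj₂ _ = d≤b
  ... | inj₁ w = ≮⇒≥ λ b<q → <⇒≱ (before b<q) u≤
    where
    q = proj₁ (remQuot (k * k) w)
    s = proj₂ (remQuot {m} (k * k) w)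
    before : toℕ b < toℕ q → toℕ (pack b x) < toℕ u
    before b<q = begin-strict
      toℕ (pack b x)                      ≡⟨ toℕ-↑ˡ _ r ⟩
      toℕ (combine b (uncurry combine x)) <⟨ combine-monoˡ-< (uncurry combine x) s b<q ⟩
      toℕ (combine q s)                   ≡⟨ cong toℕ (combine-remQuot {m} (k * k) w) ⟩
      toℕ w                               ≡⟨ toℕ-↑ˡ w r ⟨
      toℕ (w ↑ˡ r)                        ≡⟨ cong toℕ (splitAt⁻¹-↑ˡ eq) ⟩
      toℕ u                               ∎
      where open ≤-Reasoning

module Layout (k T r : ℕ) where

  -- With `3 + (T + T)` layers, layer `T + 1` is the middle one, and walks of length `T` from either
  -- end just fail to reach it.
  last : Fin (3 + (T + T))
  last = fromℕ (2 + (T + T))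

  V : Set
  V = Fin ((3 + (T + T)) * (suc k * suc k) + r)

  Cell : Set
  Cell = Fin (suc k) × Fin (suc k)

  open Packing (3 + (T + T)) (suc k) r (zero , zero , zero)

  -- Nodes are presented in index order, block by block; exchanging blocks 1
  -- and last makes the two ends of the chain the first layers presented.
  π : Permutation′ (3 + (T + T))
  π = Perm.transpose (suc zero) last

  layer : V → Fin (3 + (T + T))
  layer v = π ⟨$⟩ʳ block v

  at : Fin (3 + (T + T)) → Cell → V
  at p = pack (π ⟨$⟩ˡ p)

  layer-at : ∀ p x → layer (at p x) ≡ p
  layer-at p x rewrite unpack-pack (π ⟨$⟩ˡ p) x = Perm.inverseʳ π

  ends-first : ∀ u → toℕ (block u) ≤ 1 →
    toℕ (layer u) ≡ 0 ⊎ toℕ (layer u) ≡ 2 + (T + T)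
  ends-first u b≤1 with block u | b≤1
  ... | zero        | _        = inj₁ refl
  ... | suc zero    | _        = inj₂ (toℕ-fromℕ _)
  ... | suc (suc _) | s≤s ()

  ends-clear : ∀ u → toℕ (block u) ≤ 1 → ∀ ℓ → ℓ ≤ T → Clear layer T ℓ u
  ends-clear u b≤1 ℓ ℓ≤T with ends-first u b≤1
  ... | inj₁ eq rewrite eq = inj₁ (≤-trans (≤-reflexive (+-identityʳ ℓ)) ℓ≤T)
  ... | inj₂ eq rewrite eq = inj₂ (begin
    ℓ + (2 + T) ≤⟨ +-monoˡ-≤ (2 + T) ℓ≤T ⟩
    T + (2 + T) ≡⟨ trans (+-suc T (suc T)) (cong suc (+-suc T T)) ⟩
    2 + (T + T) ∎)
    where open ≤-Reasoning

  cell : V → Cell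
  cell = proj₂ ∘ unpack

  cell-at : ∀ p x → cell (at p x) ≡ x
  cell-at p x = cong proj₂ (unpack-pack (π ⟨$⟩ˡ p) x)

  T<last : T < toℕ last
  T<last = ≤-trans (s≤s (m≤n⇒m≤1+n (m≤m+n T T)))
    (≤-reflexive (sym (toℕ-fromℕ (2 + (T + T)))))

  pack-clear : ∀ b x → toℕ b ≤ 1 → ClearBefore layer T (pack b x)
  pack-clear b x b≤1 u u≤ = ends-clear u (≤-trans (block-mono {u} b x z≤n u≤) b≤1)

  at-zero-clear : ∀ x → ClearBefore layer T (at zero x)
  at-zero-clear x = pack-clear zero x z≤n

  at-last-clear : ∀ x → ClearBefore layer T (at last x)
  at-last-clear x = subst (λ b → ClearBefore layer T (pack b x))
    (sym (Perm.inverseˡ π {suc zero})) (pack-clear (suc zero) x (s≤s z≤n))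

  no-algorithm-on-V : ∀ {c N} → c < suc k + k →
    (3 + (T + T)) * (suc k * suc k) + r ≤ N → (out : View N → Fin c) →
    ¬ ColoursPartite ((3 + (T + T)) * (suc k * suc k) + r) (suc k) T out
  no-algorithm-on-V few n≤N =
    Twist.no-algorithm {T = T} layer cell at layer-at cell-at n≤N {last = last}
      few T<last at-zero-clear at-last-clear

-- The linear lower bound.

no-algorithm-on-large : ∀ {k c T n N} → c < suc k + k →
  (3 + (T + T)) * (suc k * suc k) ≤ n → n ≤ N → (out : View N → Fin c) →
  ¬ ColoursPartite n (suc k) T out
no-algorithm-on-large {k} {T = T} {n} {N} few large n≤N out =
  -- The excess of `n` over the size of the chain becomes the number of surplus twins.
  subst (λ n → n ≤ N → ¬ ColoursPartite n (suc k) T out)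
    (proj₂ (m≤n⇒∃[o]m+o≡n large))
    (λ n≤N → Layout.no-algorithm-on-V k T _ few n≤N out) n≤N

-- For `T` at least 1, `3 + 2 T` is at most `5 T`, whence the factor 5. For `T` zero the three
-- gadgets fit by the first hypothesis.
chain-fits : ∀ s {n} T → 3 * s ≤ n → 5 * s * T < n → (3 + (T + T)) * s ≤ n
chain-fits s zero      3s≤n _   = 3s≤n
chain-fits s {n} (suc t) _  5sT<n = begin
  (3 + (suc t + suc t)) * s             ≤⟨ m≤m+n _ _ ⟩
  (3 + (suc t + suc t)) * s + 3 * t * s ≡⟨ solve 2 (λ s t →
    (con 3 :+ ((con 1 :+ t) :+ (con 1 :+ t))) :* s :+ con 3 :* t :* s
    := con 5 :* s :* (con 1 :+ t)) refl s t ⟩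
  5 * s * suc t                         ≤⟨ <⇒≤ 5sT<n ⟩
  n                                     ∎
  where
  open ≤-Reasoning
  open +-*-Solver

theorem3 : (k : ℕ) → 2 ≤ k →
    (N : ℕ → ℕ) → PolynomialIdSpace N →
    (A : OnlineLocal N (Fin (2 * k ∸ 2))) →
    ProperlyColors A (λ G → Partite G k) →
    OnlineLocal.locality A ∈Ω (λ n → n)
theorem3 (suc k) _ N ids A proper = 5 * s , 3 * s , λ n 3s≤n →
  ≮⇒≥ λ 5sT<n → no-algorithm-on-large few
    (chain-fits s (locality n) 3s≤n 5sT<n) (enough n) (output n) proper
  where
  open OnlineLocal A
  open PolynomialIdSpace ids
  s = suc k * suc k
  -- The number of parts is now `suc k`, so there are `2 k` colours, one less than a crossing
  -- rainbow row and column show.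
  few : 2 * suc k ∸ 2 < suc k + k
  few = s≤s (≤-reflexive
    (trans (cong (_∸ 1) (+-suc k (k + 0))) (cong (k +_) (+-identityʳ k))))
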